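{- Let $R,S$ be nonnegative integral vectors such that $\mathcal{A}(R,S)$ is a convex-class, and let $A\in\mathcal{A}(R,S)$. Let $I$ and $I'$ be the horizontal intervals of two different rows of $A$. Then at least one of the following holds: (i) $|I|=|I'|=1$; (ii) $I\subseteq I'$ or $I'\subseteq I$; (iii) $I'$ is a 1-shift of $I$. In particular, if $|I|=k$ and $|I'|\ge k+1$ for some $k\ge1$, then $I\subseteq I'$. The analogous statements hold for the vertical intervals of two different columns of $A$. Moreover, for every interchange applicable to a matrix in $\mathcal{A}(R,S)$, the two rows involved either both contain exactly one $1$ or have horizontal intervals forming a 1-shift pair, and likewise the two columns involved either both contain exactly one $1$ or have vertical intervals forming a 1-shift pair.
   Context: $\mathcal{A}(R,S)$ is the set of $(0,1)$-matrices with row sum vector $R$ and column sum vector $S$. A $(0,1)$-matrix is convex if in every row and column the 1's occur consecutively; $\mathcal{A}(R,S)$ is a convex-class if every matrix in it is convex. For $A=[a_{ij}]$, the horizontal interval of row $i$ is $\{j: a_{ij}=1\}$ and the vertical interval of column $j$ is $\{i: a_{ij}=1\}$. For intervals $I=\{k,k+1,\dots,l\}$ and $I'=\{k+1,\dots,l+1\}$ with $k<l$, $I'$ is called a 1-shift of $I$ and vice versa, and $I,I'$ is a 1-shift pair. An interchange replaces a $2\times2$ submatrix $\begin{bmatrix}1&0\\0&1\end{bmatrix}$ by $\begin{bmatrix}0&1\\1&0\end{bmatrix}$ or vice versa. -}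

module Defs where

open import Data.Fin using (Fin; toℕ; _≤_; _<_; _≟_)
open import Data.Fin.Patterns using (0F; 1F)
open import Data.Fin.Subset using (Subset; _∈_; ∣_∣)
open import Data.Nat as ℕ using (ℕ; suc)
open import Data.Nat.Properties using (+-0-commutativeMonoid)
open import Data.Product using (∃; ∃₂; _×_)
open import Data.Sum using (_⊎_)
open import Data.Vec using (tabulate)
open import Data.Vec.Functional using (Vector; transpose)
open import Function using (_⇔_)
open import Relation.Binary.PropositionalEquality using (_≡_)
open import Relation.Nullary using (¬_; does)

open import Algebra.Properties.CommutativeMonoid.Sum +-0-commutativeMonoid using (sum)

private
  variable
    m n : ℕ

Matrix01 : ℕ → ℕ → Set
Matrix01 m n = Vector (Vector (Fin 2) n) m

rowSum : Matrix01 m n → Vector ℕ m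
rowSum A i = sum (λ j → toℕ (A i j))

colSum : Matrix01 m n → Vector ℕ n
colSum A j = sum (λ i → toℕ (A i j))

record _∈𝒜[_,_] (A : Matrix01 m n) (R : Vector ℕ m) (S : Vector ℕ n) : Set where
  field
    rows : ∀ i → rowSum A i ≡ R i
    cols : ∀ j → colSum A j ≡ S j

horizontal : Matrix01 m n → Fin m → Subset n
horizontal A i = tabulate (λ j → does (A i j ≟ 1F))

vertical : Matrix01 m n → Fin n → Subset m
vertical A j = horizontal (transpose A) j

-- The empty set counts as consecutive, so zero rows and columns are allowed.
Consecutive : Subset n → Set
Consecutive I = ∀ {x y z} → x ≤ y → y ≤ z → x ∈ I → z ∈ I → y ∈ I

record Convex (A : Matrix01 m n) : Set where
  field
    rows : ∀ i → Consecutive (horizontal A i)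
    cols : ∀ j → Consecutive (vertical A j)

ConvexClass : Vector ℕ m → Vector ℕ n → Set
ConvexClass R S = ∀ A → A ∈𝒜[ R , S ] → Convex A

-- I = {k, k+1, …, l}, with positions numbered from 0.
_Is[_⋯_] : Subset n → ℕ → ℕ → Set
I Is[ k ⋯ l ] = ∀ x → x ∈ I ⇔ (k ℕ.≤ toℕ x × toℕ x ℕ.≤ l)

-- The bound suc l < n keeps {k+1, …, l+1} from being truncated by Fin n.
RightShift : Subset n → Subset n → Set
RightShift {n} I I′ = ∃₂ λ k l →
  k ℕ.< l × suc l ℕ.< n × I Is[ k ⋯ l ] × I′ Is[ suc k ⋯ suc l ]

OneShift : Subset n → Subset n → Set
OneShift I I′ = RightShift I I′ ⊎ RightShift I′ I

Singletons : Subset n → Subset n → Set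
Singletons I I′ = ∣ I ∣ ≡ 1 × ∣ I′ ∣ ≡ 1

Block : Matrix01 m n → (p q : Fin m) (r s : Fin n) → (a b c d : Fin 2) → Set
Block A p q r s a b c d = (A p r ≡ a × A p s ≡ b)
                        × (A q r ≡ c × A q s ≡ d)

record Interchange (p q : Fin m) (r s : Fin n) (A B : Matrix01 m n) : Set where
  field
    p<q       : p < q
    r<s       : r < s
    replaced  : (Block A p q r s 1F 0F
                               0F 1F × Block B p q r s 0F 1F
                                                       1F 0F)
              ⊎ (Block A p q r s 0F 1F
                               1F 0F × Block B p q r s 1F 0F
                                                       0F 1F)
    elsewhere : ∀ i j → ¬ ((i ≡ p ⊎ i ≡ q) × (j ≡ r ⊎ j ≡ s)) → B i j ≡ A i j

InterchangeApplicable : (p q : Fin m) (r s : Fin n) → Matrix01 m n → Set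
InterchangeApplicable p q r s A = ∃ λ B → Interchange p q r s A B

{-# OPTIONS --safe #-}

-- If r lies in the interval of row p only and s in that of row q only, then
-- interchanging columns r and s in these two rows stays in 𝒜(R,S), so the
-- resulting rows are again intervals.  For incomparable intervals [a,b] and
-- [c,d] with a < c and b < d, the exchange of a and d forces d = b + 1 if
-- a < b, and c = a + 1 if c < d.  If only one of the intervals is a singleton,
-- exchanging its point with the adjacent end of the other row leaves a gap.
-- Columns are rows of the transposed class, and applicable interchanges
-- exhibit incomparable rows and columns.

module Submission where

open import Data.Fin as Fin using (Fin; zero; suc; toℕ; fromℕ<; _≟_)
import Data.Fin.Properties as Fin
open import Data.Fin.Patterns using (0F; 1F)
import Data.Fin.Permutation as Perm
open import Data.Fin.Permutation.Components using (transpose)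
open import Data.Fin.Subset using (Subset; Nonempty; inside; outside; ⁅_⁆; _∩_; _∪_; _∈_; _∉_; _⊆_; _⊈_; ∣_∣)
open import Data.Fin.Subset.Properties using (_∈?_; _⊆?_; nonempty?; x∈⁅x⁆; x∈⁅y⁆⇒x≡y; ∣⁅x⁆∣≡1; ⊆-antisym; p⊆q⇒∣p∣≤∣q∣; p⊂q⇒∣p∣<∣q∣; ∪-identityʳ; p∩q⊆p; p∩q⊆q; x∈p∩q⁺; x∈p∪q⁺)
open import Data.Nat as ℕ using (ℕ; _+_; _≤_; z≤n; s≤s)
import Data.Nat.Properties as ℕ
open import Data.Product using (∃; _×_; _,_; proj₁; proj₂; swap)
open import Data.Sum as Sum using (_⊎_; inj₁; inj₂; [_,_]′)
open import Data.Vec using (_∷_; here; there)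
open import Data.Vec.Functional as Vector using (Vector)
open import Data.Vec.Properties using ([]=⇒lookup; lookup⇒[]=; lookup∘tabulate)
open import Function using (_∘_; _⇔_; mk⇔; Equivalence)
open import Relation.Binary.PropositionalEquality using (_≡_; _≢_; refl; sym; trans; cong; subst)
open import Relation.Nullary using (Dec; yes; no; ¬_; contradiction; does; _⊎-dec_; _×-dec_; ¬?)
open import Relation.Nullary.Decidable using (dec-true; dec-false; decidable-stable)
open import Algebra.Properties.CommutativeMonoid.Sum ℕ.+-0-commutativeMonoid using (sum-permute; sum-cong-≗)
open import Defs

private
  variable
    m n : ℕ
    I J : Subset n

-- Subsets of Fin n

record Span (I : Subset n) : Set where
  field
    lo hi : Fin n
    lo∈   : lo ∈ I
    hi∈   : hi ∈ I
    lo≤   : ∀ {x} → x ∈ I → lo Fin.≤ x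
    ≤hi   : ∀ {x} → x ∈ I → x Fin.≤ hi

  lo≤hi : lo Fin.≤ hi
  lo≤hi = lo≤ hi∈

minimum : (I : Subset n) → Nonempty I → ∃ λ a → a ∈ I × (∀ {x} → x ∈ I → a Fin.≤ x)
minimum (inside  ∷ I) _                   = zero , here , λ _ → z≤n
minimum (outside ∷ I) (suc x , there x∈I) with minimum I (x , x∈I)
... | a , a∈I , a≤ = suc a , there a∈I , λ { (there y∈I) → s≤s (a≤ y∈I) }

-- The head is the greatest element only when the tail is empty, so emptiness of the tail is decided
-- before recursing.
maximum : (I : Subset n) → Nonempty I → ∃ λ b → b ∈ I × (∀ {x} → x ∈ I → x Fin.≤ b)
maximum (s ∷ I) ne with nonempty? I
maximum (s ∷ I) ne | yes I≢∅ with maximum I I≢∅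
... | b , b∈I , ≤b = suc b , there b∈I , λ { here → z≤n ; (there x∈I) → s≤s (≤b x∈I) }
maximum (inside ∷ I) ne | no I≡∅ =
  zero , here , λ { here → z≤n ; (there x∈I) → contradiction (_ , x∈I) I≡∅ }
maximum (outside ∷ I) (suc x , there x∈I) | no I≡∅ = contradiction (x , x∈I) I≡∅

span : {x : Fin n} → x ∈ I → Span I
span {I = I} x∈I with minimum I (_ , x∈I) | maximum I (_ , x∈I)
... | a , a∈I , a≤ | b , b∈I , ≤b = record
  { lo = a ; hi = b ; lo∈ = a∈I ; hi∈ = b∈I ; lo≤ = a≤ ; ≤hi = ≤b }

consecutive⇒Is : Consecutive I → (S : Span I) → I Is[ toℕ (Span.lo S) ⋯ toℕ (Span.hi S) ]
consecutive⇒Is I-cons S x = mk⇔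
  (λ x∈I → lo≤ x∈I , ≤hi x∈I)
  (λ (lo≤x , x≤hi) → I-cons lo≤x x≤hi lo∈ hi∈)
  where open Span S

lo≡hi⇒∣I∣≡1 : (S : Span I) → Span.lo S ≡ Span.hi S → ∣ I ∣ ≡ 1
lo≡hi⇒∣I∣≡1 {I = I} S lo≡hi = trans (cong ∣_∣ (⊆-antisym I⊆ ⊆I)) (∣⁅x⁆∣≡1 lo)
  where
  open Span S
  I⊆ : I ⊆ ⁅ lo ⁆
  I⊆ {x} x∈I = subst (_∈ ⁅ lo ⁆)
    (Fin.≤-antisym (lo≤ x∈I) (subst (x Fin.≤_) (sym lo≡hi) (≤hi x∈I))) (x∈⁅x⁆ lo)
  ⊆I : ⁅ lo ⁆ ⊆ I
  ⊆I x∈⁅lo⁆ = subst (_∈ I) (sym (x∈⁅y⁆⇒x≡y lo x∈⁅lo⁆)) lo∈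

-- Membership is decidable and `Fin n` is finite, so a double-negation argument yields an actual
-- witness.
⊈⇒∃ : (I J : Subset n) → I ⊈ J → ∃ λ x → x ∈ I × x ∉ J
⊈⇒∃ I J I⊈J = decidable-stable (Fin.any? (λ x → x ∈? I ×-dec ¬? (x ∈? J))) λ ∄x →
  I⊈J λ {x} x∈I → decidable-stable (x ∈? J) λ x∉J → ∄x (x , x∈I , x∉J)

∣I∪⁅x⁆∣≤1+∣I∣ : (I : Subset n) (x : Fin n) → ∣ I ∪ ⁅ x ⁆ ∣ ≤ ℕ.suc ∣ I ∣
∣I∪⁅x⁆∣≤1+∣I∣ (inside  ∷ I) (suc x) = s≤s (∣I∪⁅x⁆∣≤1+∣I∣ I x)
∣I∪⁅x⁆∣≤1+∣I∣ (outside ∷ I) (suc x) = ∣I∪⁅x⁆∣≤1+∣I∣ I x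
∣I∪⁅x⁆∣≤1+∣I∣ (inside  ∷ I) zero    = s≤s (ℕ.≤-trans (ℕ.≤-reflexive (cong ∣_∣ (∪-identityʳ I))) (ℕ.n≤1+n ∣ I ∣))
∣I∪⁅x⁆∣≤1+∣I∣ (outside ∷ I) zero    = s≤s (ℕ.≤-reflexive (cong ∣_∣ (∪-identityʳ I)))

-- One-shift pairs

-- The extra point `x` adds at most one to the size of `I ∩ J`, and `y` makes `I ∩ J` a proper
-- subset of `I`, which pays for it.
⊆∪⁅x⁆⇒∣J∣≤∣I∣ : {x y : Fin n} → (∀ {z} → z ∈ J → z ≢ x → z ∈ I) → y ∈ I → y ∉ J → ∣ J ∣ ≤ ∣ I ∣
⊆∪⁅x⁆⇒∣J∣≤∣I∣ {J = J} {I = I} {x} {y} J-x⊆I y∈I y∉J = begin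
  ∣ J ∣                ≤⟨ p⊆q⇒∣p∣≤∣q∣ J⊆ ⟩
  ∣ (I ∩ J) ∪ ⁅ x ⁆ ∣  ≤⟨ ∣I∪⁅x⁆∣≤1+∣I∣ (I ∩ J) x ⟩
  ℕ.suc ∣ I ∩ J ∣      ≤⟨ p⊂q⇒∣p∣<∣q∣ (p∩q⊆p I J , y , y∈I , y∉J ∘ p∩q⊆q I J) ⟩
  ∣ I ∣                ∎
  where
  open ℕ.≤-Reasoning
  J⊆ : J ⊆ (I ∩ J) ∪ ⁅ x ⁆
  J⊆ {z} z∈J with z ≟ x
  ... | yes refl = x∈p∪q⁺ {p = I ∩ J} (inj₂ (x∈⁅x⁆ x))
  ... | no  z≢x  = x∈p∪q⁺ (inj₁ (x∈p∩q⁺ (J-x⊆I z∈J z≢x , z∈J)))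

-- Apart from position `k` of `I` and position `1 + l` of `J` the two sets coincide, so the
-- preceding estimate applies in both directions.
rightShift⇒∣I∣≡∣J∣ : RightShift I J → ∣ I ∣ ≡ ∣ J ∣
rightShift⇒∣I∣≡∣J∣ {n} {I} {J} (k , l , k<l , 1+l<n , I-is , J-is) = ℕ.≤-antisym
  (⊆∪⁅x⁆⇒∣J∣≤∣I∣ {x = x} I-x⊆J y∈J y∉I)
  (⊆∪⁅x⁆⇒∣J∣≤∣I∣ {x = y} J-y⊆I x∈I x∉J)
  where
  k<n : k ℕ.< n
  k<n = ℕ.<-trans k<l (ℕ.<-trans (ℕ.n<1+n l) 1+l<n)

  x y : Fin n
  x = fromℕ< k<n
  y = fromℕ< 1+l<n

  toℕ-x : toℕ x ≡ k
  toℕ-x = Fin.toℕ-fromℕ< k<n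

  toℕ-y : toℕ y ≡ ℕ.suc l
  toℕ-y = Fin.toℕ-fromℕ< 1+l<n

  x∈I : x ∈ I
  x∈I = Equivalence.from (I-is x)
    (ℕ.≤-reflexive (sym toℕ-x) , subst (_≤ l) (sym toℕ-x) (ℕ.<⇒≤ k<l))

  x∉J : x ∉ J
  x∉J x∈J = ℕ.<-irrefl (sym toℕ-x) (proj₁ (Equivalence.to (J-is x) x∈J))

  y∈J : y ∈ J
  y∈J = Equivalence.from (J-is y)
    (subst (k ℕ.<_) (sym toℕ-y) (ℕ.m<n⇒m<1+n k<l) , ℕ.≤-reflexive toℕ-y)

  y∉I : y ∉ I
  y∉I y∈I = ℕ.<-irrefl refl (subst (_≤ l) toℕ-y (proj₂ (Equivalence.to (I-is y) y∈I)))

  I-x⊆J : ∀ {z} → z ∈ I → z ≢ x → z ∈ J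
  I-x⊆J {z} z∈I z≢x with Equivalence.to (I-is z) z∈I
  ... | k≤z , z≤l = Equivalence.from (J-is z)
    ( ℕ.≤∧≢⇒< k≤z (λ k≡z → z≢x (Fin.toℕ-injective (trans (sym k≡z) (sym toℕ-x))))
    , ℕ.m≤n⇒m≤1+n z≤l )

  J-y⊆I : ∀ {z} → z ∈ J → z ≢ y → z ∈ I
  J-y⊆I {z} z∈J z≢y with Equivalence.to (J-is z) z∈J
  ... | k<z , z≤1+l = Equivalence.from (I-is z)
    ( ℕ.<⇒≤ k<z
    , ℕ.s≤s⁻¹ (ℕ.≤∧≢⇒< z≤1+l (λ z≡1+l → z≢y (Fin.toℕ-injective (trans z≡1+l (sym toℕ-y))))) )

oneShift⇒∣I∣≡∣J∣ : OneShift I J → ∣ I ∣ ≡ ∣ J ∣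
oneShift⇒∣I∣≡∣J∣ = [ rightShift⇒∣I∣≡∣J∣ , sym ∘ rightShift⇒∣I∣≡∣J∣ ]′

-- Exchanges between two intervals

-- Both orders occur because an exchanged point may land on either side of a retained one.
Between : Fin n → Fin n → Fin n → Set
Between x y z = (x Fin.< y × y Fin.< z) ⊎ (z Fin.< y × y Fin.< x)

-- Expresses that (I ∖ {r}) ∪ {s} is consecutive whenever r ∈ I ∖ J and s ∈ J ∖ I.
Exchangeable : Subset n → Subset n → Set
Exchangeable I J = ∀ {r s x y} → r ∈ I → r ∉ J → s ∈ J → s ∉ I →
  x ∈ I → x ≢ r → Between x y s → y ∈ I × y ≢ r

-- Otherwise position `1 + x` is smaller than `z`, hence below `n`, and gives an element strictly in
-- between.
nothingBetween⇒suc : {x z : Fin n} → x Fin.< z → (∀ y → ¬ (x Fin.< y × y Fin.< z)) → toℕ z ≡ ℕ.suc (toℕ x)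
nothingBetween⇒suc {n} {x} {z} x<z none = sym (decidable-stable (_ ℕ.≟ _) λ 1+x≢z →
  let 1+x<z = ℕ.≤∧≢⇒< x<z 1+x≢z
      1+x<n = ℕ.<-trans 1+x<z (Fin.toℕ<n z)
      toℕ-y = Fin.toℕ-fromℕ< 1+x<n
  in none (fromℕ< 1+x<n)
       ( ℕ.≤-reflexive (sym toℕ-y)
       , subst (ℕ._< toℕ z) (sym toℕ-y) 1+x<z ))

staggered : Consecutive I → Consecutive J → Exchangeable I J → Exchangeable J I →
  (S : Span I) (T : Span J) → Span.lo S Fin.< Span.lo T → Span.hi S Fin.< Span.hi T →
  Singletons I J ⊎ RightShift I J
staggered {n} {I} {J} I-cons J-cons I↔J J↔I S T a<c b<d = cases (a ≟ b) (c ≟ d)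
  where
  open Span S using () renaming (lo to a; hi to b; lo∈ to a∈I; hi∈ to b∈I; ≤hi to ≤b; lo≤hi to a≤b)
  open Span T using () renaming (lo to c; hi to d; lo∈ to c∈J; hi∈ to d∈J; lo≤ to c≤; lo≤hi to c≤d)

  a∉J : a ∉ J
  a∉J a∈J = ℕ.<⇒≱ a<c (c≤ a∈J)

  d∉I : d ∉ I
  d∉I d∈I = ℕ.<⇒≱ b<d (≤b d∈I)

  cases : Dec (a ≡ b) → Dec (c ≡ d) → Singletons I J ⊎ RightShift I J
  cases (yes a≡b) (yes c≡d) = inj₁ (lo≡hi⇒∣I∣≡1 S a≡b , lo≡hi⇒∣I∣≡1 T c≡d)
  -- Row `J` gives up `c` and receives `a`. Since `d` stays, the vacated `c` is a gap between `a`
  -- and `d`.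
  cases (yes refl) (no c≢d) =
    contradiction refl (proj₂ (J↔I c∈J c∉I a∈I a∉J d∈J (c≢d ∘ sym) (inj₂ (a<c , c<d))))
    where
    c<d : c Fin.< d
    c<d = Fin.≤∧≢⇒< c≤d c≢d
    c∉I : c ∉ I
    c∉I c∈I = ℕ.<⇒≱ a<c (≤b c∈I)
  -- Mirror image: `I` gives up `b`, receives `d` and keeps `a`, so `b` becomes a gap.
  cases (no a≢b) (yes refl) =
    contradiction refl (proj₂ (I↔J b∈I b∉J d∈J d∉I a∈I a≢b (inj₁ (a<b , b<d))))
    where
    a<b : a Fin.< b
    a<b = Fin.≤∧≢⇒< a≤b a≢b
    b∉J : b ∉ J
    b∉J b∈J = ℕ.<⇒≱ b<d (c≤ b∈J)
  cases (no a≢b) (no c≢d) = inj₂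
    ( toℕ a , toℕ b , Fin.≤∧≢⇒< a≤b a≢b
    , subst (ℕ._< n) d≡1+b (Fin.toℕ<n d)
    , consecutive⇒Is I-cons S
    , subst (λ k → J Is[ k ⋯ ℕ.suc (toℕ b) ]) c≡1+a
        (subst (λ l → J Is[ toℕ c ⋯ l ]) d≡1+b (consecutive⇒Is J-cons T)) )
    where
    -- `I` gives up `a`, receives `d` and still contains `b`; a point strictly between `b` and `d`
    -- would belong to `I` beyond its last element.
    d≡1+b : toℕ d ≡ ℕ.suc (toℕ b)
    d≡1+b = nothingBetween⇒suc b<d λ y (b<y , y<d) →
      ℕ.<⇒≱ b<y (≤b (proj₁ (I↔J a∈I a∉J d∈J d∉I b∈I (a≢b ∘ sym) (inj₁ (b<y , y<d)))))
    -- Here `J` gives up `d`, receives `a` and keeps `c`, so a point in between would precede the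
    -- first element of `J`.
    c≡1+a : toℕ c ≡ ℕ.suc (toℕ a)
    c≡1+a = nothingBetween⇒suc a<c λ y (a<y , y<c) →
      ℕ.<⇒≱ y<c (c≤ (proj₁ (J↔I d∈J d∉I a∈I a∉J c∈J c≢d (inj₂ (a<y , y<c)))))

-- If the ends of one interval enclosed those of the other, it would contain the other, against `r`
-- or `s`. Both pairs of ends are therefore strictly ordered in the same direction, which is the
-- staggered case up to exchanging `I` and `J`.
incomparable : Consecutive I → Consecutive J → Exchangeable I J → Exchangeable J I →
  {r s : Fin n} → r ∈ I → r ∉ J → s ∈ J → s ∉ I → Singletons I J ⊎ OneShift I J
incomparable {I = I} {J = J} I-cons J-cons I↔J J↔I {r} {s} r∈I r∉J s∈J s∉I =
  [ (λ a≤c → let b<d = ℕ.≰⇒> (I⊉J a≤c)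
                 a<c = ℕ.≰⇒> (λ c≤a → J⊉I c≤a (ℕ.<⇒≤ b<d))
             in Sum.map₂ inj₁ (staggered I-cons J-cons I↔J J↔I S T a<c b<d))
  , (λ c≤a → let d<b = ℕ.≰⇒> (J⊉I c≤a)
                 c<a = ℕ.≰⇒> (λ a≤c → I⊉J a≤c (ℕ.<⇒≤ d<b))
             in Sum.map swap inj₂ (staggered J-cons I-cons J↔I I↔J T S c<a d<b))
  ]′ (Fin.≤-total S.lo T.lo)
  where
  S : Span I
  S = span r∈I
  T : Span J
  T = span s∈J
  module S = Span S
  module T = Span T

  I⊉J : S.lo Fin.≤ T.lo → ¬ (T.hi Fin.≤ S.hi)
  I⊉J a≤c d≤b = s∉I (I-cons (ℕ.≤-trans a≤c (T.lo≤ s∈J)) (ℕ.≤-trans (T.≤hi s∈J) d≤b) S.lo∈ S.hi∈)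

  J⊉I : T.lo Fin.≤ S.lo → ¬ (S.hi Fin.≤ T.hi)
  J⊉I c≤a b≤d = r∉J (J-cons (ℕ.≤-trans c≤a (S.lo≤ r∈I)) (ℕ.≤-trans (S.≤hi r∈I) b≤d) T.lo∈ T.hi∈)

trichotomy : Consecutive I → Consecutive J → Exchangeable I J → Exchangeable J I →
  Singletons I J ⊎ (I ⊆ J ⊎ J ⊆ I) ⊎ OneShift I J
trichotomy {I = I} {J = J} I-cons J-cons I↔J J↔I with I ⊆? J | J ⊆? I
... | yes I⊆J | _       = inj₂ (inj₁ (inj₁ I⊆J))
... | no  _   | yes J⊆I = inj₂ (inj₁ (inj₂ J⊆I))
... | no  I⊈J | no  J⊈I with ⊈⇒∃ I J I⊈J | ⊈⇒∃ J I J⊈I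
...   | r , r∈I , r∉J | s , s∈J , s∉I =
  Sum.map₂ inj₂ (incomparable I-cons J-cons I↔J J↔I r∈I r∉J s∈J s∉I)

-- Every alternative other than `I ⊆ J` forces `∣ J ∣ ≤ ∣ I ∣`; for shifts this is the equality of
-- sizes.
∣I∣<∣J∣⇒I⊆J : Singletons I J ⊎ (I ⊆ J ⊎ J ⊆ I) ⊎ OneShift I J → ∣ I ∣ ℕ.< ∣ J ∣ → I ⊆ J
∣I∣<∣J∣⇒I⊆J (inj₁ (∣I∣≡1 , ∣J∣≡1))      ∣I∣<∣J∣ = contradiction ∣I∣<∣J∣ (ℕ.<-irrefl (trans ∣I∣≡1 (sym ∣J∣≡1)))
∣I∣<∣J∣⇒I⊆J (inj₂ (inj₁ (inj₁ I⊆J)))    _       = I⊆J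
∣I∣<∣J∣⇒I⊆J (inj₂ (inj₁ (inj₂ J⊆I)))    ∣I∣<∣J∣ = contradiction ∣I∣<∣J∣ (ℕ.≤⇒≯ (p⊆q⇒∣p∣≤∣q∣ J⊆I))
∣I∣<∣J∣⇒I⊆J (inj₂ (inj₂ shift))         ∣I∣<∣J∣ = contradiction ∣I∣<∣J∣ (ℕ.<-irrefl (oneShift⇒∣I∣≡∣J∣ shift))

-- Interchanges in a class of matrices

∈-horizontal : (A : Matrix01 m n) {i : Fin m} {j : Fin n} → j ∈ horizontal A i ⇔ A i j ≡ 1F
∈-horizontal A {i} {j} = mk⇔ to from
  where
  to : j ∈ horizontal A i → A i j ≡ 1F
  to j∈ with A i j | trans (sym (lookup∘tabulate (λ j → does (A i j ≟ 1F)) j)) ([]=⇒lookup j∈)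
  ... | 1F | _  = refl
  ... | 0F | ()
  from : A i j ≡ 1F → j ∈ horizontal A i
  from Aij≡1 = lookup⇒[]= j (horizontal A i)
    (trans (lookup∘tabulate (λ j → does (A i j ≟ 1F)) j) (dec-true (A i j ≟ 1F) Aij≡1))

∉-horizontal : (A : Matrix01 m n) {i : Fin m} {j : Fin n} → j ∉ horizontal A i ⇔ A i j ≡ 0F
∉-horizontal A {i} {j} = mk⇔ (to (A i j) refl)
  (λ Aij≡0 j∈ → contradiction (trans (sym (Equivalence.to (∈-horizontal A) j∈)) Aij≡0) λ ())
  where
  to : (v : Fin 2) → A i j ≡ v → j ∉ horizontal A i → A i j ≡ 0F
  to 0F Aij≡0 _  = Aij≡0
  to 1F Aij≡1 j∉ = contradiction (Equivalence.from (∈-horizontal A) Aij≡1) j∉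

transpose-left : (i j : Fin n) → transpose i j i ≡ j
transpose-left i j rewrite dec-true (i ≟ i) refl = refl

transpose-right : (i j : Fin n) → transpose i j j ≡ i
transpose-right i j with j ≟ i
... | yes j≡i = j≡i
... | no  _ rewrite dec-true (j ≟ j) refl = refl

transpose-fixes : {i j k : Fin n} → k ≢ i → k ≢ j → transpose i j k ≡ k
transpose-fixes {i = i} {j} {k} k≢i k≢j
  rewrite dec-false (k ≟ i) k≢i | dec-false (k ≟ j) k≢j = refl

-- On an alternating block this is the interchange. Written as a permutation of entries within rows,
-- it preserves row sums whatever the entries are.
transposeColumnsIn : (p q : Fin m) (r s : Fin n) → Matrix01 m n → Matrix01 m n
transposeColumnsIn p q r s A i j with (i ≟ p) ⊎-dec (i ≟ q)
... | yes _ = A i (transpose r s j)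
... | no  _ = A i j

module _ (p q : Fin m) (r s : Fin n) (A : Matrix01 m n) where

  private
    B : Matrix01 m n
    B = transposeColumnsIn p q r s A

  transposeColumnsIn-row : ∀ j → B p j ≡ A p (transpose r s j)
  transposeColumnsIn-row j with (p ≟ p) ⊎-dec (p ≟ q)
  ... | yes _    = refl
  ... | no  p∉pq = contradiction (inj₁ refl) p∉pq

  transposeColumnsIn-rowSum : ∀ i → rowSum B i ≡ rowSum A i
  transposeColumnsIn-rowSum i with (i ≟ p) ⊎-dec (i ≟ q)
  ... | yes _ = sym (sum-permute (toℕ ∘ A i) (Perm.transpose r s))
  ... | no  _ = refl

  -- In columns r and s the exchange acts as the transposition of rows p and q.
  transposeColumnsIn-column : {j : Fin n} → A p (transpose r s j) ≡ A q j → A q (transpose r s j) ≡ A p j →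
    ∀ i → B i j ≡ A (transpose p q i) j
  transposeColumnsIn-column {j} p↦q q↦p i with (i ≟ p) ⊎-dec (i ≟ q)
  ... | yes (inj₁ refl) = trans p↦q (cong (λ i → A i j) (sym (transpose-left p q)))
  ... | yes (inj₂ refl) = trans q↦p (cong (λ i → A i j) (sym (transpose-right p q)))
  ... | no  i∉pq        = cong (λ i → A i j) (sym (transpose-fixes (i∉pq ∘ inj₁) (i∉pq ∘ inj₂)))

  -- The hypotheses say that the block is invariant under swapping its rows and its columns
  -- simultaneously. Columns `r` and `s` are thus permuted within themselves, and all others stay
  -- fixed.
  transposeColumnsIn-colSum : A p s ≡ A q r → A q s ≡ A p r → ∀ j → colSum B j ≡ colSum A j
  transposeColumnsIn-colSum Aps≡Aqr Aqs≡Apr j = cases (j ≟ r) (j ≟ s)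
    where
    permuted : A p (transpose r s j) ≡ A q j → A q (transpose r s j) ≡ A p j → colSum B j ≡ colSum A j
    permuted p↦q q↦p = trans
      (sum-cong-≗ (cong toℕ ∘ transposeColumnsIn-column p↦q q↦p))
      (sym (sum-permute (λ i → toℕ (A i j)) (Perm.transpose p q)))

    fixed : transpose r s j ≡ j → ∀ i → B i j ≡ A i j
    fixed j↦j i with (i ≟ p) ⊎-dec (i ≟ q)
    ... | yes _ = cong (A i) j↦j
    ... | no  _ = refl

    cases : Dec (j ≡ r) → Dec (j ≡ s) → colSum B j ≡ colSum A j
    cases (yes refl) _ = permuted
      (trans (cong (A p) (transpose-left r s)) Aps≡Aqr)
      (trans (cong (A q) (transpose-left r s)) Aqs≡Apr)
    cases (no _) (yes refl) = permuted
      (trans (cong (A p) (transpose-right r s)) (sym Aqs≡Apr))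
      (trans (cong (A q) (transpose-right r s)) (sym Aps≡Aqr))
    cases (no j≢r) (no j≢s) = sum-cong-≗ (cong toℕ ∘ fixed (transpose-fixes j≢r j≢s))

-- Rows of matrices in a convex class

module _ {R : Vector ℕ m} {S : Vector ℕ n} (convex : ConvexClass R S) {A : Matrix01 m n} (A∈𝒜 : A ∈𝒜[ R , S ]) where

  private
    module A∈𝒜 = _∈𝒜[_,_] A∈𝒜

  -- The interchanged matrix `B` lies in the class, so its row `p` is consecutive. That row contains
  -- the retained `x` and the new `s`, hence also `y`; as `y` is neither `r` nor `s`, it was already
  -- in row `p` of `A`.
  rows-exchangeable : ∀ p q → Exchangeable (horizontal A p) (horizontal A q)
  rows-exchangeable p q {r} {s} {x} {y} r∈p r∉q s∈q s∉p x∈p x≢r x-y-s = y∈p , y≢r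
    where
    Apr≡1 : A p r ≡ 1F
    Apr≡1 = Equivalence.to (∈-horizontal A) r∈p
    Aqr≡0 : A q r ≡ 0F
    Aqr≡0 = Equivalence.to (∉-horizontal A) r∉q
    Aqs≡1 : A q s ≡ 1F
    Aqs≡1 = Equivalence.to (∈-horizontal A) s∈q
    Aps≡0 : A p s ≡ 0F
    Aps≡0 = Equivalence.to (∉-horizontal A) s∉p

    B : Matrix01 m n
    B = transposeColumnsIn p q r s A

    B∈𝒜 : B ∈𝒜[ R , S ]
    B∈𝒜 = record
      { rows = λ i → trans (transposeColumnsIn-rowSum p q r s A i) (A∈𝒜.rows i)
      ; cols = λ j → trans
          (transposeColumnsIn-colSum p q r s A
            (trans Aps≡0 (sym Aqr≡0)) (trans Aqs≡1 (sym Apr≡1)) j)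
          (A∈𝒜.cols j)
      }

    Bp : ∀ j → B p j ≡ A p (transpose r s j)
    Bp = transposeColumnsIn-row p q r s A

    ∈B : ∀ {i j} → transpose r s i ≡ j → j ∈ horizontal A p → i ∈ horizontal B p
    ∈B {i} i↦j j∈p = Equivalence.from (∈-horizontal B {p})
      (trans (Bp i) (trans (cong (A p) i↦j) (Equivalence.to (∈-horizontal A) j∈p)))

    ∈A : ∀ {i j} → transpose r s i ≡ j → i ∈ horizontal B p → j ∈ horizontal A p
    ∈A {i} i↦j i∈p = Equivalence.from (∈-horizontal A)
      (trans (cong (A p) (sym i↦j)) (trans (sym (Bp i)) (Equivalence.to (∈-horizontal B {p}) i∈p)))

    x∈B : x ∈ horizontal B p
    x∈B = ∈B (transpose-fixes x≢r λ { refl → s∉p x∈p }) x∈p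

    s∈B : s ∈ horizontal B p
    s∈B = ∈B (transpose-right r s) r∈p

    y∈B : y ∈ horizontal B p
    y∈B = [ (λ (x<y , y<s) → Convex.rows (convex B B∈𝒜) p (ℕ.<⇒≤ x<y) (ℕ.<⇒≤ y<s) x∈B s∈B)
          , (λ (s<y , y<x) → Convex.rows (convex B B∈𝒜) p (ℕ.<⇒≤ s<y) (ℕ.<⇒≤ y<x) s∈B x∈B)
          ]′ x-y-s

    y≢r : y ≢ r
    -- Entry `r` of the new row is the old entry `s`, which is zero.
    y≢r refl = s∉p (∈A (transpose-left r s) y∈B)

    y≢s : y ≢ s
    y≢s y≡s = [ (λ (_ , y<s) → Fin.<⇒≢ y<s y≡s) , (λ (s<y , _) → Fin.<⇒≢ s<y (sym y≡s)) ]′ x-y-s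

    y∈p : y ∈ horizontal A p
    y∈p = ∈A (transpose-fixes y≢r y≢s) y∈B

  rows-trichotomy : ∀ i i′ → let I = horizontal A i; I′ = horizontal A i′ in
    Singletons I I′ ⊎ (I ⊆ I′ ⊎ I′ ⊆ I) ⊎ OneShift I I′
  rows-trichotomy i i′ = trichotomy (rows i) (rows i′) (rows-exchangeable i i′) (rows-exchangeable i′ i)
    where open Convex (convex A A∈𝒜)

  rows-nested : ∀ i i′ → let I = horizontal A i; I′ = horizontal A i′ in
    (k : ℕ) → 1 ≤ k → ∣ I ∣ ≡ k → k + 1 ≤ ∣ I′ ∣ → I ⊆ I′
  rows-nested i i′ k _ refl k+1≤∣I′∣ =
    ∣I∣<∣J∣⇒I⊆J (rows-trichotomy i i′) (subst (_≤ ∣ horizontal A i′ ∣) (ℕ.+-comm k 1) k+1≤∣I′∣)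

  -- The four entries put `r` in row `p` only and `s` in row `q` only, so neither row contains the
  -- other.
  rows-incomparable : ∀ {p q r s} → A p r ≡ 1F → A q r ≡ 0F → A q s ≡ 1F → A p s ≡ 0F →
    Singletons (horizontal A p) (horizontal A q) ⊎ OneShift (horizontal A p) (horizontal A q)
  rows-incomparable {p} {q} Apr≡1 Aqr≡0 Aqs≡1 Aps≡0 =
    incomparable (rows p) (rows q) (rows-exchangeable p q) (rows-exchangeable q p)
      (Equivalence.from (∈-horizontal A) Apr≡1) (Equivalence.from (∉-horizontal A) Aqr≡0)
      (Equivalence.from (∈-horizontal A) Aqs≡1) (Equivalence.from (∉-horizontal A) Aps≡0)
    where open Convex (convex A A∈𝒜)

-- Passage to columns and the theorem

transpose-∈𝒜 : {R : Vector ℕ m} {S : Vector ℕ n} {A : Matrix01 m n} →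
  A ∈𝒜[ R , S ] → Vector.transpose A ∈𝒜[ S , R ]
transpose-∈𝒜 A∈𝒜 = record { rows = cols ; cols = rows }
  where open _∈𝒜[_,_] A∈𝒜

transpose-convexClass : {R : Vector ℕ m} {S : Vector ℕ n} → ConvexClass R S → ConvexClass S R
transpose-convexClass convex A A∈𝒜 = record { rows = cols ; cols = rows }
  where open Convex (convex (Vector.transpose A) (transpose-∈𝒜 A∈𝒜))

mainTheorem9 : ∀ (m n : ℕ) (R : Vector ℕ m) (S : Vector ℕ n) → ConvexClass R S →
    (∀ (A : Matrix01 m n) → A ∈𝒜[ R , S ] →
      (∀ (i i′ : Fin m) → i ≢ i′ →
        let I = horizontal A i
            I′ = horizontal A i′
        in (Singletons I I′ ⊎ (I ⊆ I′ ⊎ I′ ⊆ I) ⊎ OneShift I I′)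
           × (∀ (k : ℕ) → 1 ≤ k → ∣ I ∣ ≡ k → k + 1 ≤ ∣ I′ ∣ → I ⊆ I′))
      ×
      (∀ (j j′ : Fin n) → j ≢ j′ →
        let J = vertical A j
            J′ = vertical A j′
        in (Singletons J J′ ⊎ (J ⊆ J′ ⊎ J′ ⊆ J) ⊎ OneShift J J′)
           × (∀ (k : ℕ) → 1 ≤ k → ∣ J ∣ ≡ k → k + 1 ≤ ∣ J′ ∣ → J ⊆ J′)))
    ×
    (∀ (A : Matrix01 m n) → A ∈𝒜[ R , S ] →
      ∀ (p q : Fin m) (r s : Fin n) → InterchangeApplicable p q r s A →
        (Singletons (horizontal A p) (horizontal A q) ⊎ OneShift (horizontal A p) (horizontal A q))
        × (Singletons (vertical A r) (vertical A s) ⊎ OneShift (vertical A r) (vertical A s)))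
mainTheorem9 m n R S convex =
  (λ A A∈𝒜 → let Aᵀ∈𝒜 = transpose-∈𝒜 A∈𝒜 in
      (λ i i′ _ → rows-trichotomy convex A∈𝒜 i i′ , rows-nested convex A∈𝒜 i i′)
    , (λ j j′ _ → rows-trichotomy convexᵀ Aᵀ∈𝒜 j j′ , rows-nested convexᵀ Aᵀ∈𝒜 j j′))
  , interchange
  where
  convexᵀ : ConvexClass S R
  convexᵀ = transpose-convexClass convex

  interchange : ∀ A → A ∈𝒜[ R , S ] → ∀ p q r s → InterchangeApplicable p q r s A →
    (Singletons (horizontal A p) (horizontal A q) ⊎ OneShift (horizontal A p) (horizontal A q))
    × (Singletons (vertical A r) (vertical A s) ⊎ OneShift (vertical A r) (vertical A s))
  interchange A A∈𝒜 p q r s (B , exchange) with Interchange.replaced exchange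
  ... | inj₁ (((pr , ps) , (qr , qs)) , _) =
    rows-incomparable convex A∈𝒜 pr qr qs ps , rows-incomparable convexᵀ (transpose-∈𝒜 A∈𝒜) pr ps qs qr
  -- For the opposite block, `r` and `s` trade roles in the row statement, and `p` and `q` trade
  -- roles in the column statement; this keeps the order of each pair in the conclusion.
  ... | inj₂ (((pr , ps) , (qr , qs)) , _) =
    rows-incomparable convex A∈𝒜 ps qs qr pr , rows-incomparable convexᵀ (transpose-∈𝒜 A∈𝒜) qr qs ps pr
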